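{- Let $k\geq 3$ and let $G$ be a graph with maximum degree $\Delta(G)\le k$ that is $0$-saturated. Then $G$ is $(1^{k-1},3)$-packing colorable.
   Context: Graphs are finite and simple; $\mathrm{dist}(x,y)$ is the usual shortest-path distance. For a non-decreasing sequence of positive integers $S=(s_1,\dots,s_p)$, an $S$-packing coloring of $G$ is a partition of $V(G)$ into sets $V_1,\dots,V_p$ such that any two distinct vertices of $V_i$ are at distance greater than $s_i$, for each $1\le i\le p$; $G$ is $S$-packing colorable if such a partition exists. The notation $i^r$ in a sequence means that $i$ is repeated $r$ times, so $(1^{k-1},3)$ is the sequence consisting of $k-1$ ones followed by a single $3$. A vertex of degree $k$ is called a $k$-vertex. A graph $G$ with $\Delta(G)\le k$ is called $t$-saturated ($0\le t\le k$) if every $k$-vertex of $G$ is adjacent to at most $t$ vertices of degree $k$; in particular $0$-saturated means no two vertices of degree $k$ are adjacent. -}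

module Defs where

open import Data.Nat using (ℕ; zero; suc; _+_; _≤_; _≡ᵇ_)
open import Data.Bool using (Bool; true; false; if_then_else_; _∧_)
open import Data.Fin using (Fin)
open import Data.List using (List; map; allFin)
open import Data.Nat.ListAction using (sum)
open import Data.Vec using (Vec; lookup; replicate; _++_; _∷_; [])
open import Data.Product using (∃; _×_)
open import Relation.Binary.PropositionalEquality using (_≡_; _≢_)
open import Relation.Nullary using (¬_)

record Graph : Set where
  field
    n      : ℕ
    adj    : Fin n → Fin n → Bool
    sym    : ∀ x y → adj x y ≡ adj y x
    irrefl : ∀ x → adj x x ≡ false

open Graph public

countB : {n : ℕ} → (Fin n → Bool) → ℕ
countB {n} P = sum (map (λ y → if P y then 1 else 0) (allFin n))

deg : (G : Graph) → Fin (n G) → ℕ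
deg G x = countB (adj G x)

MaxDegLe : Graph → ℕ → Set
MaxDegLe G k = ∀ x → deg G x ≤ k

Saturated : (G : Graph) → (k t : ℕ) → Set
Saturated G k t =
  ∀ x → deg G x ≡ k → countB (λ y → adj G x y ∧ (deg G y ≡ᵇ k)) ≤ t

data Walk (G : Graph) : Fin (n G) → Fin (n G) → ℕ → Set where
  here : ∀ x → Walk G x x 0
  step : ∀ {x y z m} → adj G x y ≡ true → Walk G y z m → Walk G x z (suc m)

-- dist(x,y) ≤ d  (shortest-path distance; false if x,y are in different components)
DistLe : (G : Graph) → Fin (n G) → Fin (n G) → ℕ → Set
DistLe G x y d = ∃ λ m → m ≤ d × Walk G x y m

IsPackingColoring : (G : Graph) {p : ℕ} → Vec ℕ p → (Fin (n G) → Fin p) → Set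
IsPackingColoring G S c =
  ∀ x y → x ≢ y → c x ≡ c y → ¬ DistLe G x y (lookup S (c x))

PackingColorable : (G : Graph) {p : ℕ} → Vec ℕ p → Set
PackingColorable G S = ∃ λ c → IsPackingColoring G S c

ones-then-3 : (r : ℕ) → Vec ℕ (r + 1)
ones-then-3 r = replicate r 1 ++ (3 ∷ [])

{-# OPTIONS --safe #-}
-- Among the proper partial colourings with k − 1 colours, take one minimising
-- the total weight of its uncoloured vertices, where a k-vertex weighs 3 and
-- any other vertex weighs 2.  An uncoloured vertex x sees every colour, and
-- exchanging it with its only neighbour of some colour preserves properness.
-- Such an exchange would lighten an uncoloured k-vertex, because its neighbours
-- are not k-vertices and some colour occurs only once around it (k ≥ 3).  Hence
-- an uncoloured vertex has degree k − 1 and sees each colour exactly once, so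
-- no two uncoloured vertices are adjacent.  If two of them had a common
-- neighbour w, giving both the colour of w and uncolouring w would reduce the
-- weight from 4 to at most 3.  If they were joined by a path x a b y, one of a
-- and b, say b, would not be a k-vertex; exchanging y and b keeps the weight
-- minimal and leaves x and b uncoloured with the common neighbour a.
module Submission where

open import Defs hiding (sym)
open import Data.Bool using (Bool; true; false; if_then_else_; _∧_)
open import Data.Bool.Properties using () renaming (_≟_ to _≟ᵇ_)
open import Data.Empty using (⊥)
open import Data.Fin using (Fin; zero; suc; splitAt; _↑ˡ_; _↑ʳ_)
open import Data.Fin.Properties using (_≟_; any?; all?; suc-injective; ↑ˡ-injective; splitAt-↑ˡ; splitAt-↑ʳ)
open import Data.List using (map; allFin; tabulate)
open import Data.List.Properties using (map-tabulate; map-cong)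
open import Data.Nat using (ℕ; zero; suc; _+_; _≤_; _<_; _∸_; _≡ᵇ_; z≤n; s≤s)
open import Data.Nat.Induction using (<-wellFounded)
open import Data.Nat.ListAction using (sum)
import Data.Nat.Properties as ℕ
open import Data.Product using (∃; _×_; _,_; proj₁; proj₂)
open import Data.Vec as Vec using (Vec; lookup; replicate; []; _∷_)
open import Data.Vec.Functional as Vector using (Vector; updateAt)
open import Data.Vec.Functional.Properties using (updateAt-updates; updateAt-minimal)
open import Data.Vec.Properties using (lookup-++ˡ; lookup-++ʳ; lookup-replicate; lookup∘tabulate)
open import Algebra.Properties.CommutativeSemigroup ℕ.+-commutativeSemigroup using (x∙yz≈y∙xz)
open import Function using (_∘_; id; const)
open import Function.Definitions using (Injective)
open import Induction.WellFounded using (Acc; acc)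
open import Relation.Binary.PropositionalEquality
open import Relation.Nullary using (¬_; Dec; yes; no; contradiction; _×-dec_; _→-dec_; ¬?)
open import Relation.Nullary.Decidable using (dec-true; dec-false; map′)

private
  variable
    A : Set
    m p q : ℕ

-- Pointwise updates, finite sums and counting.

infixl 6 _[_≔_]

_[_≔_] : Vector A q → Fin q → A → Vector A q
c [ x ≔ a ] = updateAt c x (const a)

≔-at : (c : Vector A q) (x : Fin q) {a : A} → (c [ x ≔ a ]) x ≡ a
≔-at c x = updateAt-updates x c

≔-off : (c : Vector A q) {x v : Fin q} {a : A} → v ≢ x → (c [ x ≔ a ]) v ≡ c v
≔-off c {x} {v} = updateAt-minimal v x c

∑ : (Fin q → ℕ) → ℕ
∑ {q} f = sum (map f (allFin q))

∑≡sum-tabulate : (f : Fin q → ℕ) → ∑ f ≡ sum (tabulate f)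
∑≡sum-tabulate f = cong sum (map-tabulate id f)

∑-cong : {f g : Fin q → ℕ} → f ≗ g → ∑ f ≡ ∑ g
∑-cong {q} f≗g = cong sum (map-cong f≗g (allFin q))

-- Both sides are moved so that no subtraction occurs.
∑-≔ : (h : Fin q → A → ℕ) (c : Vector A q) (x : Fin q) (a : A) →
      h x (c x) + ∑ (λ v → h v ((c [ x ≔ a ]) v)) ≡ h x a + ∑ (λ v → h v (c v))
∑-≔ {q} h c x a = begin
  h x (c x) + ∑ (λ v → h v ((c [ x ≔ a ]) v))
    ≡⟨ cong (h x (c x) +_) (∑≡sum-tabulate λ v → h v ((c [ x ≔ a ]) v)) ⟩
  h x (c x) + sum (tabulate (λ v → h v ((c [ x ≔ a ]) v)))
    ≡⟨ tabulated h c x ⟩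
  h x a + sum (tabulate (λ v → h v (c v)))
    ≡⟨ cong (h x a +_) (∑≡sum-tabulate λ v → h v (c v)) ⟨
  h x a + ∑ (λ v → h v (c v)) ∎
  where
  open ≡-Reasoning
  tabulated : ∀ {q} (h : Fin q → _ → ℕ) (c : Vector _ q) (x : Fin q) →
              h x (c x) + sum (tabulate (λ v → h v ((c [ x ≔ a ]) v)))
                ≡ h x a + sum (tabulate (λ v → h v (c v)))
  tabulated h c zero = x∙yz≈y∙xz (h zero (c zero)) (h zero a) _
  tabulated h c (suc x) = begin
    h (suc x) (c (suc x)) + (h zero (c zero) + _)
      ≡⟨ x∙yz≈y∙xz (h (suc x) (c (suc x))) (h zero (c zero)) _ ⟩
    h zero (c zero) + (h (suc x) (c (suc x)) + _)
      ≡⟨ cong (h zero (c zero) +_) (tabulated (h ∘ suc) (c ∘ suc) x) ⟩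
    h zero (c zero) + (h (suc x) a + _)
      ≡⟨ x∙yz≈y∙xz (h zero (c zero)) (h (suc x) a) _ ⟩
    h (suc x) a + (h zero (c zero) + _) ∎

-- Induction on `m`: switching `P` off at `f zero` lowers the count by one, and injectivity keeps
-- `P` true at the other values of `f`.
injective⇒≤countB : (P : Fin q → Bool) (f : Fin m → Fin q) → Injective _≡_ _≡_ f →
                    (∀ i → P (f i) ≡ true) → m ≤ countB P
injective⇒≤countB {m = zero} P f inj Pf = z≤n
injective⇒≤countB {m = suc m} P f inj Pf = subst (suc m ≤_) count (s≤s rest)
  where
  P′ = P [ f zero ≔ false ]
  ind : Bool → ℕ
  ind b = if b then 1 else 0
  rest : m ≤ countB P′
  rest = injective⇒≤countB P′ (f ∘ suc) (suc-injective ∘ inj)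
    (λ i → trans (≔-off P (λ eq → contradiction (inj eq) λ ())) (Pf (suc i)))
  count : suc (countB P′) ≡ countB P
  count = subst (λ b → ind b + countB P′ ≡ countB P) (Pf zero)
            (∑-≔ (const ind) P (f zero) false)

∷-injective : {f : Vector (Fin q) m} {a : Fin q} → Injective _≡_ _≡_ f → (∀ i → a ≢ f i) →
              Injective _≡_ _≡_ (a Vector.∷ f)
∷-injective inj a∉ {zero}  {zero}  _  = refl
∷-injective inj a∉ {zero}  {suc j} eq = contradiction eq (a∉ j)
∷-injective inj a∉ {suc i} {zero}  eq = contradiction (sym eq) (a∉ i)
∷-injective inj a∉ {suc i} {suc j} eq = cong suc (inj eq)

-- Makes the search for a lighter colouring finite: vectors can be enumerated by induction on their
-- length.
∃Vec? : {P : Vec (Fin p) q → Set} → (∀ v → Dec (P v)) → Dec (∃ P)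
∃Vec? {q = zero}  P? = map′ ([] ,_) (λ { ([] , Pv) → Pv }) (P? [])
∃Vec? {q = suc q} P? = map′ (λ { (a , v , Pv) → a ∷ v , Pv }) (λ { (a ∷ v , Pv) → a , v , Pv })
                            (any? λ a → ∃Vec? (λ v → P? (a ∷ v)))

-- The number r of colours is k − 1.
module _ (G : Graph) (r : ℕ) where

  private
    V = Fin (n G)

  -- Proper partial colourings, their weight and minimality.

  infix 4 _~_

  _~_ : V → V → Set
  x ~ y = adj G x y ≡ true

  ~-sym : ∀ {x y} → x ~ y → y ~ x
  ~-sym {x} {y} x~y = trans (Graph.sym G y x) x~y

  ~-irrefl : ∀ {x y} → x ~ y → x ≢ y
  ~-irrefl {x} x~x refl = contradiction (trans (sym x~x) (irrefl G x)) λ ()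

  -- The value zero means uncoloured.
  Colouring : Set
  Colouring = Vector (Fin (suc r)) (n G)

  -- Concluding `c u ≡ zero` instead of a contradiction lets uncoloured vertices be adjacent.
  Proper : Colouring → Set
  Proper c = ∀ u v → u ~ v → c u ≡ c v → c u ≡ zero

  proper? : ∀ c → Dec (Proper c)
  proper? c = all? λ u → all? λ v →
    (adj G u v ≟ᵇ true) →-dec ((c u ≟ c v) →-dec (c u ≟ zero))

  proper-≔ : ∀ {c} x j → Proper c → (∀ z → x ~ z → c z ≡ j → j ≡ zero) → Proper (c [ x ≔ j ])
  proper-≔ {c} x j pr free u v u~v eq with u ≟ x | v ≟ x
  ... | yes refl | yes refl = contradiction refl (~-irrefl u~v)
  ... | yes refl | no v≢x   = trans (≔-at c x)
        (free v u~v (trans (sym (≔-off c v≢x)) (trans (sym eq) (≔-at c x))))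
  ... | no u≢x   | yes refl = trans eq (trans (≔-at c x)
        (free u (~-sym u~v) (trans (sym (≔-off c u≢x)) (trans eq (≔-at c x)))))
  ... | no u≢x   | no v≢x   = trans (≔-off c u≢x)
        (pr u v u~v (trans (sym (≔-off c u≢x)) (trans eq (≔-off c v≢x))))

  exchange : Colouring → V → V → Fin r → Colouring
  exchange c x y i = c [ y ≔ zero ] [ x ≔ suc i ]

  -- Uncolouring `y` first removes the only conflict that colouring `x` could create.
  proper-exchange : ∀ {c x y i} → Proper c → (∀ z → x ~ z → c z ≡ suc i → z ≡ y) →
                    Proper (exchange c x y i)
  proper-exchange {c} {x} {y} {i} pr only = proper-≔ x (suc i) (proper-≔ y zero pr λ _ _ _ → refl) free
    where
    free : ∀ z → x ~ z → (c [ y ≔ zero ]) z ≡ suc i → suc i ≡ zero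
    free z x~z eq with z ≟ y
    ... | yes refl = trans (sym eq) (≔-at c y)
    ... | no z≢y   = contradiction (only z x~z (trans (sym (≔-off c z≢y)) eq)) z≢y

  -- The values 3 and 2 make a k-vertex heavier than any other vertex, yet lighter than two
  -- non-k-vertices together.
  weight : V → ℕ
  weight v = 2 + (if deg G v ≡ᵇ suc r then 1 else 0)

  weight-k : ∀ {v} → deg G v ≡ suc r → weight v ≡ 3
  weight-k {v} eq = cong (λ b → 2 + (if b then 1 else 0)) (dec-true (deg G v ℕ.≟ suc r) eq)

  weight-non-k : ∀ {v} → deg G v ≢ suc r → weight v ≡ 2
  weight-non-k {v} neq = cong (λ b → 2 + (if b then 1 else 0)) (dec-false (deg G v ℕ.≟ suc r) neq)

  weight≤3 : ∀ v → weight v ≤ 3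
  weight≤3 v with deg G v ≡ᵇ suc r
  ... | true  = ℕ.≤-refl
  ... | false = ℕ.n≤1+n 2

  cost : V → Fin (suc r) → ℕ
  cost v zero    = weight v
  cost v (suc _) = 0

  Φ : Colouring → ℕ
  Φ c = ∑ (λ v → cost v (c v))

  Φ-colour : ∀ c {x} i → c x ≡ zero → weight x + Φ (c [ x ≔ suc i ]) ≡ Φ c
  Φ-colour c {x} i cx = subst (λ a → cost x a + Φ (c [ x ≔ suc i ]) ≡ Φ c) cx (∑-≔ cost c x (suc i))

  Φ-uncolour : ∀ c {y i} → c y ≡ suc i → Φ (c [ y ≔ zero ]) ≡ weight y + Φ c
  Φ-uncolour c {y} cy =
    subst (λ a → cost y a + Φ (c [ y ≔ zero ]) ≡ weight y + Φ c) cy (∑-≔ cost c y zero)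

  Φ-exchange : ∀ c {x y i} → c x ≡ zero → c y ≡ suc i →
               weight x + Φ (exchange c x y i) ≡ weight y + Φ c
  Φ-exchange c {x} {y} {i} cx cy = trans
    -- Only `y` carries a colour, so `x` and `y` differ and `x` is still uncoloured after the first
    -- update.
    (Φ-colour (c [ y ≔ zero ]) i (trans (≔-off c (λ { refl → contradiction (trans (sym cx) cy) λ () })) cx))
    (Φ-uncolour c cy)

  Minimal : Colouring → Set
  Minimal c = Proper c × (∀ c′ → Proper c′ → Φ c ≤ Φ c′)

  ∃-minimal : ∃ Minimal
  ∃-minimal = descend (const zero) (λ _ _ _ _ → refl) (<-wellFounded _)
    where
    descend : ∀ c → Proper c → Acc _<_ (Φ c) → ∃ Minimal
    descend c pr (acc rec)
      with ∃Vec? (λ v → proper? (lookup v) ×-dec (Φ (lookup v) ℕ.<? Φ c))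
    ... | yes (v , pr′ , lt) = descend (lookup v) pr′ (rec lt)
    -- A competitor `c′` agrees only pointwise with its tabulation, so properness and weight are
    -- carried over vertex by vertex.
    ... | no ∄ = c , pr , λ c′ pr′ → ℕ.≮⇒≥ λ lt → ∄
      ( Vec.tabulate c′
      , (λ x y x~y eq → trans (at c′ x)
           (pr′ x y x~y (trans (sym (at c′ x)) (trans eq (at c′ y)))))
      , subst (_< Φ c) (∑-cong (λ v → cong (cost v) (sym (at c′ v)))) lt )
      where
      at = lookup∘tabulate

  -- A colour missing around `x` could be given to `x`, saving its positive weight.
  sees-all-colours : ∀ {c x} → Minimal c → c x ≡ zero → ∀ i → ∃ λ y → x ~ y × c y ≡ suc i
  sees-all-colours {c} {x} (pr , min) cx i
    with any? (λ y → (adj G x y ≟ᵇ true) ×-dec (c y ≟ suc i))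
  ... | yes found = found
  ... | no none = contradiction (min c′ pr′) (ℕ.<⇒≱ lighter)
    where
    c′ = c [ x ≔ suc i ]
    pr′ : Proper c′
    pr′ = proper-≔ x (suc i) pr λ z x~z cz → contradiction (z , x~z , cz) none
    lighter : Φ c′ < Φ c
    lighter = subst (Φ c′ <_) (Φ-colour c i cx) (s≤s (ℕ.m≤n+m (Φ c′) _))

  -- Neighbourhoods of uncoloured vertices in a minimal colouring.

  module _ (2≤r : 2 ≤ r) (Δ≤k : MaxDegLe G (suc r)) (saturated : Saturated G (suc r) 0) where

    -- A k-vertex next to `x` would be a true entry in a count bounded by 0.
    k-vertices-nonadjacent : ∀ {x y} → x ~ y → deg G x ≡ suc r → deg G y ≢ suc r
    k-vertices-nonadjacent {x} {y} x~y dx dy = ℕ.<⇒≱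
      (injective⇒≤countB {m = 1} _ (const y) (λ { {zero} {zero} _ → refl })
        (λ _ → cong₂ _∧_ x~y (dec-true (deg G y ℕ.≟ suc r) dy)))
      (saturated x dx)

    module Uncoloured {c} (min : Minimal c) {x} (cx : c x ≡ zero) where

      private
        rep : Fin r → V
        rep i = proj₁ (sees-all-colours min cx i)

        x~rep : ∀ i → x ~ rep i
        x~rep i = proj₁ (proj₂ (sees-all-colours min cx i))

        c-rep : ∀ i → c (rep i) ≡ suc i
        c-rep i = proj₂ (proj₂ (sees-all-colours min cx i))

        rep-injective : Injective _≡_ _≡_ rep
        rep-injective {i} {j} eq =
          suc-injective (trans (sym (c-rep i)) (trans (cong c eq) (c-rep j)))

        Repeated : Fin r → Set
        Repeated i = ∃ λ z → x ~ z × c z ≡ suc i × rep i ≢ z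

        repeated? : ∀ i → Dec (Repeated i)
        repeated? i = any? λ z → (adj G x z ≟ᵇ true) ×-dec ((c z ≟ suc i) ×-dec ¬? (rep i ≟ z))

        repeated∉rep : ∀ {i} ((z , _) : Repeated i) → ∀ j → z ≢ rep j
        repeated∉rep {i} (z , _ , cz , i≢z) j refl with trans (sym cz) (c-rep j)
        ... | refl = i≢z refl

        -- Two repeated colours would give x at least r + 2 = k + 1 neighbours.
        ∃-unrepeated : ∃ λ i → ¬ Repeated i
        ∃-unrepeated = search 2≤r repeated?
          where
          too-many : ∀ {i j} → i ≢ j → Repeated i → Repeated j → ⊥
          too-many {i} {j} i≢j R@(z , x~z , cz , _) R′@(z′ , x~z′ , cz′ , _) =
            ℕ.<⇒≱ (injective⇒≤countB (adj G x) (z Vector.∷ (z′ Vector.∷ rep))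
                    (∷-injective (∷-injective rep-injective (repeated∉rep R′))
                      λ { zero refl → i≢j (suc-injective (trans (sym cz) cz′))
                        ; (suc l) → repeated∉rep R l })
                    λ { zero → x~z ; (suc zero) → x~z′ ; (suc (suc l)) → x~rep l })
                  (Δ≤k x)
          search : 2 ≤ r → (∀ i → Dec (Repeated i)) → ∃ λ i → ¬ Repeated i
          search (s≤s (s≤s _)) R? with R? zero | R? (suc zero)
          ... | no ¬R | _ = zero , ¬R
          ... | yes _ | no ¬R = suc zero , ¬R
          ... | yes R | yes R′ = contradiction R′ (too-many (λ ()) R)

      uncoloured-non-k : deg G x ≢ suc r
      uncoloured-non-k dx with ∃-unrepeated
      ... | i , ¬R = contradiction (proj₂ min c′ (proper-exchange (proj₁ min) only)) (ℕ.<⇒≱ lighter)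
        where
        c′ = exchange c x (rep i) i
        only : ∀ z → x ~ z → c z ≡ suc i → z ≡ rep i
        only z x~z cz with rep i ≟ z
        ... | yes eq = sym eq
        ... | no neq = contradiction (z , x~z , cz , neq) ¬R
        lighter : Φ c′ < Φ c
        -- The exchange trades weight 3 for weight 2, so `3 + Φ c′` equals `2 + Φ c`.
        lighter = ℕ.+-cancelˡ-≤ 2 (suc (Φ c′)) (Φ c) (ℕ.≤-reflexive (subst₂ (λ a b → a + Φ c′ ≡ b + Φ c)
          (weight-k dx) (weight-non-k (k-vertices-nonadjacent (x~rep i) dx))
          (Φ-exchange c cx (c-rep i))))

      private
        -- A neighbour outside `rep` would bring the degree of `x` to r + 1 = k, which is excluded
        -- for uncoloured vertices.
        nbr-rep : ∀ {z} → x ~ z → ∃ λ i → z ≡ rep i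
        nbr-rep {z} x~z with any? (λ i → z ≟ rep i)
        ... | yes found = found
        ... | no none = contradiction (ℕ.≤-antisym (Δ≤k x) many) uncoloured-non-k
          where
          many : suc r ≤ deg G x
          many = injective⇒≤countB (adj G x) (z Vector.∷ rep)
            (∷-injective rep-injective (λ i eq → none (i , eq)))
            λ { zero → x~z ; (suc i) → x~rep i }

      nbr-coloured : ∀ {z} → x ~ z → ∃ λ i → c z ≡ suc i
      nbr-coloured x~z with nbr-rep x~z
      ... | i , refl = i , c-rep i

      nbr-colours-distinct : ∀ {z z′} → x ~ z → x ~ z′ → c z ≡ c z′ → z ≡ z′
      nbr-colours-distinct x~z x~z′ eq with nbr-rep x~z | nbr-rep x~z′
      ... | i , refl | j , refl =
        cong rep (suc-injective (trans (sym (c-rep i)) (trans eq (c-rep j))))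

      nbr≢uncoloured : ∀ {z} → x ~ z → c z ≢ zero
      nbr≢uncoloured x~z cz with nbr-coloured x~z
      ... | i , eq = contradiction (trans (sym cz) eq) λ ()

    -- Distances between uncoloured vertices.

    open Uncoloured

    no-common-neighbour : ∀ {c x y w} → Minimal c → c x ≡ zero → c y ≡ zero → x ≢ y →
                          x ~ w → y ~ w → ⊥
    no-common-neighbour {c} {x} {y} {w} min cx cy x≢y x~w y~w with nbr-coloured min cx x~w
    ... | i , cw = ℕ.<⇒≱ lighter (proj₂ min c₂ proper₂)
      where
      c₁ = exchange c x w i
      c₂ = c₁ [ y ≔ suc i ]
      proper₁ : Proper c₁
      proper₁ = proper-exchange (proj₁ min)
        λ z x~z cz → nbr-colours-distinct min cx x~z x~w (trans cz (sym cw))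
      w≢x = ~-irrefl (~-sym x~w)
      proper₂ : Proper c₂
      proper₂ = proper-≔ y (suc i) proper₁ free
        where
        free : ∀ z → y ~ z → c₁ z ≡ suc i → suc i ≡ zero
        -- `c₁` differs from `c` only at `x`, which is no neighbour of `y`, and at `w`, now
        -- uncoloured; elsewhere `w` was the only neighbour of `y` with this colour.
        free z y~z eq with z ≟ x | z ≟ w
        ... | yes refl | _ = contradiction cx (nbr≢uncoloured min cy y~z)
        ... | no z≢x | yes refl = trans (sym eq) (trans (≔-off _ z≢x) (≔-at c w))
        ... | no z≢x | no z≢w = contradiction
          (nbr-colours-distinct min cy y~z y~w
            (trans (sym (trans (≔-off _ z≢x) (≔-off c z≢w))) (trans eq (sym cw)))) z≢w
      c₁y : c₁ y ≡ zero
      c₁y = trans (≔-off _ (x≢y ∘ sym)) (trans (≔-off c (~-irrefl y~w)) cy)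
      -- The 4 is the joint weight of `x` and `y`, neither a k-vertex; uncolouring `w` costs at most
      -- 3.
      balance : 4 + Φ c₂ ≡ weight w + Φ c
      balance = trans
        (cong₂ (λ a b → a + (b + Φ c₂)) (sym (weight-non-k (uncoloured-non-k min cx)))
                                        (sym (weight-non-k (uncoloured-non-k min cy))))
        (trans (cong (weight x +_) (Φ-colour c₁ i c₁y)) (Φ-exchange c cx cw))
      lighter : Φ c₂ < Φ c
      lighter = ℕ.+-cancelˡ-≤ 3 (suc (Φ c₂)) (Φ c)
        (ℕ.≤-trans (ℕ.≤-reflexive balance) (ℕ.+-monoˡ-≤ (Φ c) (weight≤3 w)))

    no-path-via-non-k : ∀ {c x a b y} → Minimal c → c x ≡ zero → c y ≡ zero → x ≢ y →
                        x ~ a → a ~ b → b ~ y → deg G b ≢ suc r → ⊥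
    no-path-via-non-k {c} {x} {a} {b} {y} min cx cy x≢y x~a a~b b~y db
      with nbr-coloured min cy (~-sym b~y)
    ... | i , cb = no-common-neighbour min′ c′x c′b x≢b x~a (~-sym a~b)
      where
      c′ = exchange c y b i
      -- The walk may repeat vertices, but `b` is coloured as a neighbour of the uncoloured `y`.
      x≢b : x ≢ b
      x≢b refl = nbr≢uncoloured min cy (~-sym b~y) cx
      c′x : c′ x ≡ zero
      c′x = trans (≔-off _ x≢y) (trans (≔-off c x≢b) cx)
      c′b : c′ b ≡ zero
      c′b = trans (≔-off _ (~-irrefl b~y)) (≔-at c b)
      Φ-equal : Φ c′ ≡ Φ c
      Φ-equal = ℕ.+-cancelˡ-≡ 2 _ _ (subst₂ (λ a b → a + Φ c′ ≡ b + Φ c)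
        (weight-non-k (uncoloured-non-k min cy)) (weight-non-k db) (Φ-exchange c cy cb))
      min′ : Minimal c′
      min′ = proper-exchange (proj₁ min)
               (λ z y~z cz → nbr-colours-distinct min cy y~z (~-sym b~y) (trans cz (sym cb)))
           , λ d pr → subst (_≤ Φ d) (sym Φ-equal) (proj₂ min d pr)

    no-path₃ : ∀ {c x a b y} → Minimal c → c x ≡ zero → c y ≡ zero → x ≢ y →
               x ~ a → a ~ b → b ~ y → ⊥
    no-path₃ {b = b} min cx cy x≢y x~a a~b b~y with deg G b ℕ.≟ suc r
    ... | no db  = no-path-via-non-k min cx cy x≢y x~a a~b b~y db
    -- If `b` is a k-vertex then `a` is not, and the path is read backwards.
    ... | yes db = no-path-via-non-k min cy cx (x≢y ∘ sym) (~-sym b~y) (~-sym a~b) (~-sym x~a)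
                     (k-vertices-nonadjacent (~-sym a~b) db)

    uncoloured-far : ∀ {c x y} → Minimal c → c x ≡ zero → c y ≡ zero → x ≢ y → ¬ DistLe G x y 3
    uncoloured-far min cx cy x≢y (_ , _ , here _) = x≢y refl
    uncoloured-far min cx cy x≢y (_ , _ , step e (here _)) = nbr≢uncoloured min cx e cy
    uncoloured-far min cx cy x≢y (_ , _ , step e (step f (here _))) =
      no-common-neighbour min cx cy x≢y e (~-sym f)
    uncoloured-far min cx cy x≢y (_ , _ , step e (step f (step g (here _)))) =
      no-path₃ min cx cy x≢y e f g
    uncoloured-far min cx cy x≢y (_ , s≤s (s≤s (s≤s ())) , step _ (step _ (step _ (step _ _))))

  coloured-far : ∀ {c x y i} → Proper c → c x ≡ suc i → c y ≡ suc i → x ≢ y → ¬ DistLe G x y 1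
  coloured-far pr cx cy x≢y (_ , _ , here _) = x≢y refl
  coloured-far pr cx cy x≢y (_ , _ , step e (here _)) =
    contradiction (trans (sym cx) (pr _ _ e (trans cx (sym cy)))) λ ()
  coloured-far pr cx cy x≢y (_ , s≤s () , step _ (step _ _))

class : ∀ r → Fin (suc r) → Fin (r + 1)
-- The uncoloured vertices form the last class, whose entry in the sequence is 3.
class r zero    = r ↑ʳ zero
class r (suc i) = i ↑ˡ 1

class-injective : ∀ r → Injective _≡_ _≡_ (class r)
class-injective r {zero}  {zero}  eq = refl
class-injective r {zero}  {suc j} eq
  with trans (sym (splitAt-↑ʳ r 1 zero)) (trans (cong (splitAt r) eq) (splitAt-↑ˡ r j 1))
... | ()
class-injective r {suc i} {zero}  eq
  with trans (sym (splitAt-↑ˡ r i 1)) (trans (cong (splitAt r) eq) (splitAt-↑ʳ r 1 zero))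
... | ()
class-injective r {suc i} {suc j} eq = cong suc (↑ˡ-injective 1 i j eq)

lookup-class-zero : ∀ r → lookup (ones-then-3 r) (class r zero) ≡ 3
lookup-class-zero r = lookup-++ʳ (replicate r 1) (3 ∷ []) zero

lookup-class-suc : ∀ r i → lookup (ones-then-3 r) (class r (suc i)) ≡ 1
lookup-class-suc r i = trans (lookup-++ˡ (replicate r 1) (3 ∷ []) i) (lookup-replicate i 1)

theorem2p1 : (k : ℕ) → 3 ≤ k → (G : Graph) → MaxDegLe G k → Saturated G k 0 →
    PackingColorable G (ones-then-3 (k ∸ 1))
theorem2p1 (suc r) (s≤s 2≤r) G Δ≤k saturated with ∃-minimal G r
... | c , min = class r ∘ c , λ x y x≢y eq → separate x≢y (class-injective r eq) (c x) refl
  where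
  -- Generalising `c x` to `a` lets a case split on `a` select the entry of the sequence while
  -- keeping the equation for `c x`.
  separate : ∀ {x y} → x ≢ y → c x ≡ c y → ∀ a → c x ≡ a →
             ¬ DistLe G x y (lookup (ones-then-3 r) (class r a))
  separate {x} {y} x≢y cx≡cy zero cx near =
    uncoloured-far G r 2≤r Δ≤k saturated min cx (trans (sym cx≡cy) cx) x≢y
      (subst (DistLe G x y) (lookup-class-zero r) near)
  separate {x} {y} x≢y cx≡cy (suc i) cx near =
    coloured-far G r (proj₁ min) cx (trans (sym cx≡cy) cx) x≢y
      (subst (DistLe G x y) (lookup-class-suc r i) near)
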